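{- There is a function $\varepsilon:\mathbb{N}\to\mathbb{R}$ with $\varepsilon(n)\to 0$ as $n\to\infty$ such that the following holds for every $n\in\mathbb{N}$: if $\mathcal{A}\subset\mathcal{P}[n]$ is a family of subsets of $[n]=\{1,\ldots,n\}$ such that $|A\setminus B|\neq 1$ for all $A,B\in\mathcal{A}$, then \[ |\mathcal{A}| \le \frac{2+\varepsilon(n)}{n}\binom{n}{\lfloor n/2\rfloor}. \] (That is, $|\mathcal{A}|\le \frac{2+o(1)}{n}\binom{n}{\lfloor n/2\rfloor}$.)
   Context: $\mathcal{P}[n]$ denotes the power set of $[n]=\{1,\ldots,n\}$. The $o(1)$ term tends to $0$ as $n\to\infty$ and does not depend on the family $\mathcal{A}$. -}

module Defs where

open import Data.Nat using (ℕ; suc; _≤_; _*_; _/_)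
open import Data.Nat.Combinatorics using (_C_)
open import Data.Integer using (+_)
open import Data.Rational as ℚ using (ℚ)
open import Data.Fin.Subset using (Subset; _─_; ∣_∣)
open import Data.List using (List)
open import Data.List.Membership.Propositional using (_∈_)
open import Data.Product using (∃)
open import Relation.Binary.PropositionalEquality using (_≢_)

toℚ : ℕ → ℚ
toℚ m = (+ m) ℚ./ 1

TendsToZero : (ℕ → ℚ) → Set
TendsToZero ε = (k : ℕ) → ∃ λ N → (n : ℕ) → N ≤ n → ℚ.∣ ε n ∣ ℚ.≤ (+ 1) ℚ./ suc k

NoDiffOne : {n : ℕ} → List (Subset n) → Set
NoDiffOne {n} 𝒜 = (A B : Subset n) → A ∈ 𝒜 → B ∈ 𝒜 → ∣ A ─ B ∣ ≢ 1

centralBinom : ℕ → ℕ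
centralBinom n = n C (n / 2)

{-# OPTIONS --safe #-}
-- Walk upwards through P[n] by adding uniformly random elements one at a time, and say that S is
-- hit by x ∉ S if S ∪ {x} ∈ 𝒜.  A set is hit by at most one x, and the sets hit at level i number
-- (i + 1) |𝒜_{i+1}|.  Once the walk has been hit at S by x, a later set S′ ∌ x can only be hit by x
-- itself.  So at each step the next hit requires adding x, or the at most one z with
-- S′ ∪ {x, z} ∈ 𝒜: two elements out of at least N if the walk stops at level n - N.  Over w levels
-- the expected number of hits is therefore at most (1 + 2/N)^w, which is 1 + o(1) on a window of
-- w = o(n) levels around n/2.  As in the LYM inequality this gives
-- Σ_i (i + 1) |𝒜_{i+1}| ≤ (1 + o(1)) C(n, n/2) over the window, where i + 1 ≥ (1/2 - o(1)) n; the
-- levels outside it are negligible because binomial coefficients decay geometrically there.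
module Submission where

open import Defs
open import Data.Bool using (if_then_else_)
import Data.Bool.Properties as Bool
open import Data.Fin using (Fin; zero; suc)
open import Data.Fin.Subset using (Subset; inside; outside; _─_; ∣_∣)
open import Data.Fin.Subset.Properties using (∣p∣≤n)
import Data.Integer as ℤ
import Data.Integer.Properties as ℤ
open import Data.List using (List; []; _∷_; length)
open import Data.List.Membership.Propositional using (_∈_)
open import Data.List.Relation.Unary.All as All using ()
open import Data.List.Relation.Unary.AllPairs using ([]; _∷_)
open import Data.List.Relation.Unary.Any using (here; there)
open import Data.List.Relation.Unary.Unique.Propositional using (Unique)
open import Data.Nat
open import Data.Nat.Combinatorics using (_C_; nCk+nC[k+1]≡[n+1]C[k+1]; nCk≡nC[n∸k])
open import Data.Nat.DivMod using (m≡m%n+[m/n]*n; m%n<n; m/n*n≤m; m*n/n≡m; /-monoˡ-≤)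
open import Data.Nat.Properties
open import Data.Nat.Tactic.RingSolver using (solve-∀)
open import Data.Product using (Σ; ∃; _×_; _,_)
open import Data.Rational as ℚ using (ℚ)
import Data.Rational.Properties as ℚ
open import Data.Rational.Unnormalised as ℚᵘ using (mkℚᵘ)
import Data.Rational.Unnormalised.Properties as ℚᵘ
open import Data.Sum using (_⊎_; inj₁; inj₂)
open import Data.Vec using ([]; _∷_; lookup; _[_]≔_)
open import Data.Vec.Properties using (≡-dec; lookup∘update; lookup∘update′; []≔-commutes)
open import Function using (_∘_)
open import Relation.Binary.Definitions using (DecidableEquality)
open import Relation.Binary.PropositionalEquality
open import Relation.Nullary using (does; yes; no; contradiction)

private
  variable
    n : ℕ

  +-interchange : ∀ a b c d → a + b + (c + d) ≡ a + c + (b + d)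
  +-interchange = solve-∀

-- Sums over sets

infixl 7 _⊹_

_⊹_ : Subset n → Fin n → Subset n
S ⊹ x = S [ x ]≔ inside

sumOut : Subset n → (Fin n → ℕ) → ℕ
sumOut []            g = 0
sumOut (inside  ∷ S) g = sumOut S (g ∘ suc)
sumOut (outside ∷ S) g = g zero + sumOut S (g ∘ suc)

codim : Subset n → ℕ
codim S = sumOut S (λ _ → 1)

-- The recursion splits on the first element as Pascal's rule does, so that counting a level yields
-- `n C i` directly.
sumLevel : ∀ n → ℕ → (Subset n → ℕ) → ℕ
sumLevel zero    zero    f = f []
sumLevel zero    (suc i) f = 0
sumLevel (suc n) zero    f = sumLevel n zero (f ∘ (outside ∷_))
sumLevel (suc n) (suc i) f = sumLevel n (suc i) (f ∘ (outside ∷_)) + sumLevel n i (f ∘ (inside ∷_))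

sumOut-mono : (S : Subset n) {f g : Fin n → ℕ} →
  (∀ z → lookup S z ≡ outside → f z ≤ g z) → sumOut S f ≤ sumOut S g
sumOut-mono []            h = z≤n
sumOut-mono (inside  ∷ S) h = sumOut-mono S (h ∘ suc)
sumOut-mono (outside ∷ S) h = +-mono-≤ (h zero refl) (sumOut-mono S (h ∘ suc))

sumOut-+ : (S : Subset n) (f g : Fin n → ℕ) →
  sumOut S (λ z → f z + g z) ≡ sumOut S f + sumOut S g
sumOut-+ []            f g = refl
sumOut-+ (inside  ∷ S) f g = sumOut-+ S (f ∘ suc) (g ∘ suc)
sumOut-+ (outside ∷ S) f g rewrite sumOut-+ S (f ∘ suc) (g ∘ suc) =
  +-interchange (f zero) (g zero) _ _

sumOut-*ʳ : (S : Subset n) (f : Fin n → ℕ) (c : ℕ) →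
  sumOut S (λ z → f z * c) ≡ sumOut S f * c
sumOut-*ʳ []            f c = refl
sumOut-*ʳ (inside  ∷ S) f c = sumOut-*ʳ S (f ∘ suc) c
sumOut-*ʳ (outside ∷ S) f c rewrite sumOut-*ʳ S (f ∘ suc) c = sym (*-distribʳ-+ c (f zero) _)

sumOut-const : (S : Subset n) (c : ℕ) → sumOut S (λ _ → c) ≡ codim S * c
sumOut-const S c = trans (sumOut-≡ S) (sumOut-*ʳ S (λ _ → 1) c)
  where
  sumOut-≡ : ∀ {n} (S : Subset n) → sumOut S (λ _ → c) ≡ sumOut S (λ _ → 1 * c)
  sumOut-≡ S = cong (λ d → sumOut S (λ _ → d)) (sym (*-identityˡ c))

sumOut-split : (S : Subset n) (x : Fin n) (g : Fin n → ℕ) → lookup S x ≡ outside →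
  sumOut S g ≡ g x + sumOut (S ⊹ x) g
sumOut-split (outside ∷ S) zero    g refl = refl
sumOut-split (inside  ∷ S) (suc x) g x∉S  = sumOut-split S x (g ∘ suc) x∉S
sumOut-split (outside ∷ S) (suc x) g x∉S
  rewrite sumOut-split S x (g ∘ suc) x∉S = swap (g zero) (g (suc x)) _
  where
  swap : ∀ a b c → a + (b + c) ≡ b + (a + c)
  swap = solve-∀

sumOut-zero? : (S : Subset n) (g : Fin n → ℕ) →
  sumOut S g ≡ 0 ⊎ ∃ λ x → lookup S x ≡ outside × g x ≢ 0
sumOut-zero? []            g = inj₁ refl
sumOut-zero? (inside  ∷ S) g with sumOut-zero? S (g ∘ suc)
... | inj₁ eq              = inj₁ eq
... | inj₂ (x , x∉S , gx)  = inj₂ (suc x , x∉S , gx)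
sumOut-zero? (outside ∷ S) g with g zero ≟ 0 | sumOut-zero? S (g ∘ suc)
... | no g0  | _                     = inj₂ (zero , refl , g0)
... | yes g0 | inj₁ eq               = inj₁ (cong₂ _+_ g0 eq)
... | yes _  | inj₂ (x , x∉S , gx)   = inj₂ (suc x , x∉S , gx)

-- Level `i` enters as `codim S + i ≡ n`, because the walks need the number of elements still
-- outside `S`.
sumLevel-mono : ∀ n i {f g : Subset n → ℕ} →
  (∀ S → codim S + i ≡ n → f S ≤ g S) → sumLevel n i f ≤ sumLevel n i g
sumLevel-mono zero    zero    h = h [] refl
sumLevel-mono zero    (suc i) h = z≤n
sumLevel-mono (suc n) zero    h =
  sumLevel-mono n zero (λ S eq → h (outside ∷ S) (cong suc eq))
sumLevel-mono (suc n) (suc i) h = +-mono-≤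
  (sumLevel-mono n (suc i) (λ S eq → h (outside ∷ S) (cong suc eq)))
  (sumLevel-mono n i (λ S eq → h (inside ∷ S) (trans (+-suc _ i) (cong suc eq))))

sumLevel-+ : ∀ n i (f g : Subset n → ℕ) →
  sumLevel n i (λ S → f S + g S) ≡ sumLevel n i f + sumLevel n i g
sumLevel-+ zero    zero    f g = refl
sumLevel-+ zero    (suc i) f g = refl
sumLevel-+ (suc n) zero    f g = sumLevel-+ n zero _ _
sumLevel-+ (suc n) (suc i) f g
  rewrite sumLevel-+ n (suc i) (f ∘ (outside ∷_)) (g ∘ (outside ∷_))
        | sumLevel-+ n i (f ∘ (inside ∷_)) (g ∘ (inside ∷_)) =
  +-interchange (sumLevel n (suc i) (f ∘ (outside ∷_))) _ _ _

sumLevel-*ʳ : ∀ n i (f : Subset n → ℕ) (c : ℕ) →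
  sumLevel n i (λ S → f S * c) ≡ sumLevel n i f * c
sumLevel-*ʳ zero    zero    f c = refl
sumLevel-*ʳ zero    (suc i) f c = refl
sumLevel-*ʳ (suc n) zero    f c = sumLevel-*ʳ n zero _ c
sumLevel-*ʳ (suc n) (suc i) f c
  rewrite sumLevel-*ʳ n (suc i) (f ∘ (outside ∷_)) c
        | sumLevel-*ʳ n i (f ∘ (inside ∷_)) c =
  sym (*-distribʳ-+ c (sumLevel n (suc i) (f ∘ (outside ∷_))) _)

sumLevel-1 : ∀ n i → sumLevel n i (λ _ → 1) ≡ n C i
sumLevel-1 zero    zero    = refl
sumLevel-1 zero    (suc i) = refl
sumLevel-1 (suc n) zero    = sumLevel-1 n zero
sumLevel-1 (suc n) (suc i)
  rewrite sumLevel-1 n (suc i) | sumLevel-1 n i =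
  trans (+-comm (n C suc i) (n C i)) (nCk+nC[k+1]≡[n+1]C[k+1] n i)

sumLevel-const : ∀ n i c → sumLevel n i (λ _ → c) ≡ (n C i) * c
sumLevel-const n i c = begin
  sumLevel n i (λ _ → c)      ≡⟨ cong (λ d → sumLevel n i (λ _ → d)) (*-identityˡ c) ⟨
  sumLevel n i (λ _ → 1 * c)  ≡⟨ sumLevel-*ʳ n i (λ _ → 1) c ⟩
  sumLevel n i (λ _ → 1) * c  ≡⟨ cong (_* c) (sumLevel-1 n i) ⟩
  (n C i) * c                 ∎
  where open ≡-Reasoning

-- Double counting of the pairs S ⊂ T with ∣ S ∣ = i and ∣ T ∣ = i + 1.
sumLevel-sumOut : ∀ n i (f : Subset n → ℕ) →
  sumLevel n i (λ S → sumOut S (λ z → f (S ⊹ z))) ≡ suc i * sumLevel n (suc i) f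
sumLevel-sumOut zero    zero    f = refl
sumLevel-sumOut zero    (suc i) f = sym (*-zeroʳ i)
sumLevel-sumOut (suc n) zero    f = begin
  sumLevel n 0 (λ S → f (inside ∷ S) + sumOut S (λ z → f (outside ∷ (S ⊹ z))))
    ≡⟨ sumLevel-+ n 0 _ _ ⟩
  sumLevel n 0 (f ∘ (inside ∷_)) + sumLevel n 0 (λ S → sumOut S (λ z → f (outside ∷ (S ⊹ z))))
    ≡⟨ cong (sumLevel n 0 (f ∘ (inside ∷_)) +_) (sumLevel-sumOut n 0 (f ∘ (outside ∷_))) ⟩
  sumLevel n 0 (f ∘ (inside ∷_)) + 1 * sumLevel n 1 (f ∘ (outside ∷_))
    ≡⟨ rearrange (sumLevel n 0 (f ∘ (inside ∷_))) _ ⟩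
  1 * (sumLevel n 1 (f ∘ (outside ∷_)) + sumLevel n 0 (f ∘ (inside ∷_))) ∎
  where
  open ≡-Reasoning
  rearrange : ∀ a b → a + 1 * b ≡ 1 * (b + a)
  rearrange = solve-∀
sumLevel-sumOut (suc n) (suc i) f = begin
  sumLevel n (suc i) (λ S → f (inside ∷ S) + sumOut S (λ z → f (outside ∷ (S ⊹ z))))
    + sumLevel n i (λ S → sumOut S (λ z → f (inside ∷ (S ⊹ z))))
    ≡⟨ cong₂ _+_ (sumLevel-+ n (suc i) _ _) (sumLevel-sumOut n i (f ∘ (inside ∷_))) ⟩
  a + sumLevel n (suc i) (λ S → sumOut S (λ z → f (outside ∷ (S ⊹ z)))) + suc i * a
    ≡⟨ cong (λ t → a + t + suc i * a) (sumLevel-sumOut n (suc i) (f ∘ (outside ∷_))) ⟩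
  a + suc (suc i) * b + suc i * a
    ≡⟨ rearrange a b i ⟩
  suc (suc i) * (b + a) ∎
  where
  open ≡-Reasoning
  a = sumLevel n (suc i) (f ∘ (inside ∷_))
  b = sumLevel n (suc (suc i)) (f ∘ (outside ∷_))
  rearrange : ∀ a b i → a + suc (suc i) * b + suc i * a ≡ suc (suc i) * (b + a)
  rearrange = solve-∀

sumLevel-cong : ∀ n i {f g : Subset n → ℕ} →
  (∀ S → codim S + i ≡ n → f S ≡ g S) → sumLevel n i f ≡ sumLevel n i g
sumLevel-cong n i h = ≤-antisym
  (sumLevel-mono n i (λ S eq → ≤-reflexive (h S eq)))
  (sumLevel-mono n i (λ S eq → ≤-reflexive (sym (h S eq))))

-- Double counting with weight 1: every set of level `i` has exactly `m` supersets one level up.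
absorption : ∀ m i → ((m + i) C i) * m ≡ suc i * ((m + i) C suc i)
absorption m i = begin
  ((m + i) C i) * m                           ≡⟨ sumLevel-const (m + i) i m ⟨
  sumLevel (m + i) i (λ _ → m)                ≡⟨ sumLevel-cong (m + i) i (λ S eq → sym (+-cancelʳ-≡ i _ _ eq)) ⟩
  sumLevel (m + i) i codim                    ≡⟨ sumLevel-sumOut (m + i) i (λ _ → 1) ⟩
  suc i * sumLevel (m + i) (suc i) (λ _ → 1)  ≡⟨ cong (suc i *_) (sumLevel-1 (m + i) (suc i)) ⟩
  suc i * ((m + i) C suc i)                   ∎
  where open ≡-Reasoning

term≤sumLevel : ∀ {n} (A : Subset n) (f : Subset n → ℕ) → f A ≤ sumLevel n ∣ A ∣ f
term≤sumLevel []            f = ≤-refl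
term≤sumLevel (inside  ∷ A) f = ≤-trans (term≤sumLevel A (f ∘ (inside ∷_))) (m≤n+m _ _)
term≤sumLevel (outside ∷ A) f = ≤-trans (term≤sumLevel A (f ∘ (outside ∷_))) (outside≤ ∣ A ∣)
  where
  outside≤ : ∀ i → sumLevel _ i (f ∘ (outside ∷_)) ≤ sumLevel _ i f
  outside≤ zero    = ≤-refl
  outside≤ (suc i) = m≤m+n _ _

-- Sums over levels

sumFrom : (ℕ → ℕ) → ℕ → ℕ → ℕ
sumFrom f i zero    = 0
sumFrom f i (suc m) = f i + sumFrom f (suc i) m

sumFrom-+ : ∀ f i p q → sumFrom f i (p + q) ≡ sumFrom f i p + sumFrom f (p + i) q
sumFrom-+ f i zero    q = refl
sumFrom-+ f i (suc p) q rewrite sumFrom-+ f (suc i) p q | +-suc p i = sym (+-assoc (f i) _ _)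

term≤sumFrom : ∀ f i m j → j < m → f (j + i) ≤ sumFrom f i m
term≤sumFrom f i (suc m) zero    _         = m≤m+n (f i) _
term≤sumFrom f i (suc m) (suc j) (s≤s j<m) = ≤-trans
  (≤-trans (≤-reflexive (cong f (sym (+-suc j i)))) (term≤sumFrom f (suc i) m j j<m))
  (m≤n+m _ (f i))

sumFrom-scaled-≤ : ∀ f i m X B → (∀ j → i ≤ j → j < m + i → f j * X ≤ B) → sumFrom f i m * X ≤ m * B
sumFrom-scaled-≤ f i zero    X B h = z≤n
sumFrom-scaled-≤ f i (suc m) X B h = ≤-trans (≤-reflexive (*-distribʳ-+ X (f i) _))
  (+-mono-≤ (h i ≤-refl (s≤s (m≤n+m i m)))
    (sumFrom-scaled-≤ f (suc i) m X B (λ j i<j j< → h j (<⇒≤ i<j) (subst (j <_) (+-suc m i) j<))))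

*-sumFrom-≤ : ∀ (f : ℕ → ℕ) i m → i * sumFrom f i m ≤ sumFrom (λ j → j * f j) i m
*-sumFrom-≤ f i zero    = ≤-reflexive (*-zeroʳ i)
*-sumFrom-≤ f i (suc m) = begin
  i * (f i + sumFrom f (suc i) m)        ≡⟨ *-distribˡ-+ i (f i) _ ⟩
  i * f i + i * sumFrom f (suc i) m      ≤⟨ +-monoʳ-≤ (i * f i) (*-monoˡ-≤ (sumFrom f (suc i) m) (n≤1+n i)) ⟩
  i * f i + suc i * sumFrom f (suc i) m  ≤⟨ +-monoʳ-≤ (i * f i) (*-sumFrom-≤ f (suc i) m) ⟩
  i * f i + sumFrom (λ j → j * f j) (suc i) m ∎
  where open ≤-Reasoning

sumFrom-suc : ∀ (f : ℕ → ℕ) i m → sumFrom (f ∘ suc) i m ≡ sumFrom f (suc i) m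
sumFrom-suc f i zero    = refl
sumFrom-suc f i (suc m) = cong (f (suc i) +_) (sumFrom-suc f (suc i) m)

sumFrom-cong : ∀ {f g} i m → (∀ j → f j ≡ g j) → sumFrom f i m ≡ sumFrom g i m
sumFrom-cong i zero    h = refl
sumFrom-cong i (suc m) h = cong₂ _+_ (h i) (sumFrom-cong (suc i) m h)

sumFrom-distrib-+ : ∀ f g i m → sumFrom (λ j → f j + g j) i m ≡ sumFrom f i m + sumFrom g i m
sumFrom-distrib-+ f g i zero    = refl
sumFrom-distrib-+ f g i (suc m) rewrite sumFrom-distrib-+ f g (suc i) m =
  +-interchange (f i) (g i) (sumFrom f (suc i) m) (sumFrom g (suc i) m)

-- Binomial coefficients

m≤n⇒∃[o]o+m≡n : ∀ {m n} → m ≤ n → ∃ λ o → o + m ≡ n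
m≤n⇒∃[o]o+m≡n {m} {n} m≤n = n ∸ m , m∸n+n≡m m≤n

C-positive : ∀ m i → 0 < (m + i) C i
C-positive m zero    = s≤s z≤n
C-positive m (suc i) rewrite +-suc m i = <-≤-trans (C-positive m i)
  (≤-trans (m≤m+n _ _) (≤-reflexive (nCk+nC[k+1]≡[n+1]C[k+1] (m + i) i)))

C-step : ∀ n i → i + suc i ≤ n → n C i ≤ n C suc i
C-step n i 2i<n with m , refl ← m≤n⇒∃[o]o+m≡n (≤-trans (m≤m+n i (suc i)) 2i<n) =
  *-cancelʳ-≤ _ _ (suc i) (begin
  ((m + i) C i) * suc i    ≤⟨ *-monoʳ-≤ ((m + i) C i) (+-cancelˡ-≤ i _ _ (≤-trans 2i<n (≤-reflexive (+-comm m i)))) ⟩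
  ((m + i) C i) * m        ≡⟨ absorption m i ⟩
  suc i * ((m + i) C suc i)  ≡⟨ *-comm (suc i) _ ⟩
  ((m + i) C suc i) * suc i ∎)
  where open ≤-Reasoning

C-mono : ∀ n i d → (d + i) + (d + i) ≤ suc n → n C i ≤ n C (d + i)
C-mono n i zero    h = ≤-refl
C-mono n i (suc d) h = ≤-trans
  (C-mono n i d (≤-trans (+-mono-≤ (n≤1+n (d + i)) (n≤1+n (d + i))) h))
  (C-step n (d + i) (s≤s⁻¹ h))

n≤1+[n/2]*2 : ∀ n → n ≤ suc (n / 2 * 2)
n≤1+[n/2]*2 n = ≤-trans (≤-reflexive (m≡m%n+[m/n]*n n 2)) (+-monoˡ-≤ (n / 2 * 2) (s≤s⁻¹ (m%n<n n 2)))

C≤central-lower : ∀ n i → i ≤ n / 2 → n C i ≤ centralBinom n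
C≤central-lower n i i≤ with d , eq ← m≤n⇒∃[o]o+m≡n i≤ =
  subst (λ c → n C i ≤ n C c) eq (C-mono n i d (begin
    (d + i) + (d + i)   ≡⟨ cong₂ _+_ eq eq ⟩
    n / 2 + n / 2       ≡⟨ double (n / 2) ⟩
    n / 2 * 2           ≤⟨ m≤n+m _ (n % 2) ⟩
    n % 2 + n / 2 * 2   ≡⟨ m≡m%n+[m/n]*n n 2 ⟨
    n                   ≤⟨ n≤1+n n ⟩
    suc n               ∎))
  where
  open ≤-Reasoning
  double : ∀ a → a + a ≡ a * 2
  double = solve-∀

C≤central : ∀ n i → i ≤ n → n C i ≤ centralBinom n
C≤central n i i≤n with i ≤? n / 2
... | yes i≤ = C≤central-lower n i i≤
... | no i≰  = subst (_≤ centralBinom n) (sym (nCk≡nC[n∸k] i≤n)) (C≤central-lower n (n ∸ i) (begin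
  n ∸ i                          ≤⟨ ∸-mono (n≤1+[n/2]*2 n) (≰⇒> i≰) ⟩
  suc (n / 2 * 2) ∸ suc (n / 2)  ≡⟨ cong (_∸ n / 2) (double (n / 2)) ⟩
  n / 2 + n / 2 ∸ n / 2          ≡⟨ m+n∸n≡m (n / 2) (n / 2) ⟩
  n / 2                          ∎))
  where
  open ≤-Reasoning
  double : ∀ a → a * 2 ≡ a + a
  double = solve-∀

-- This is `absorption` with the exact factors weakened to an `x` and a `y` that can stay fixed over
-- a range of levels.
C-ratio : ∀ n i x y → x + i ≤ n → suc i ≤ y → (n C i) * x ≤ y * (n C suc i)
C-ratio n i x y x+i≤n i<y with m , refl ← m≤n⇒∃[o]o+m≡n (≤-trans (m≤n+m i x) x+i≤n) = begin
  ((m + i) C i) * x          ≤⟨ *-monoʳ-≤ ((m + i) C i) (+-cancelʳ-≤ i x m x+i≤n) ⟩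
  ((m + i) C i) * m          ≡⟨ absorption m i ⟩
  suc i * ((m + i) C suc i)  ≤⟨ *-monoˡ-≤ ((m + i) C suc i) i<y ⟩
  y * ((m + i) C suc i)      ∎
  where open ≤-Reasoning

C-growth : ∀ n j x y t → x + (t + j) ≤ suc n → t + j ≤ y → (n C j) * x ^ t ≤ y ^ t * (n C (t + j))
C-growth n j x y zero    _ _ = ≤-reflexive (*-comm (n C j) 1)
C-growth n j x y (suc t) h₁ h₂ = begin
  (n C j) * (x * x ^ t)                    ≡⟨ rearrange₁ (n C j) x (x ^ t) ⟩
  (n C j) * x ^ t * x                      ≤⟨ *-monoˡ-≤ x (C-growth n j x y t (m≤n⇒m≤1+n x+i≤n) (≤-trans (n≤1+n _) h₂)) ⟩
  y ^ t * (n C (t + j)) * x                ≡⟨ *-assoc (y ^ t) _ x ⟩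
  y ^ t * ((n C (t + j)) * x)              ≤⟨ *-monoʳ-≤ (y ^ t) (C-ratio n (t + j) x y x+i≤n h₂) ⟩
  y ^ t * (y * (n C suc (t + j)))          ≡⟨ rearrange₂ (y ^ t) y (n C suc (t + j)) ⟩
  y * y ^ t * (n C suc (t + j))            ∎
  where
  open ≤-Reasoning
  x+i≤n : x + (t + j) ≤ n
  x+i≤n = s≤s⁻¹ (≤-trans (≤-reflexive (sym (+-suc x (t + j)))) h₁)
  rearrange₁ : ∀ a x z → a * (x * z) ≡ a * z * x
  rearrange₁ = solve-∀
  rearrange₂ : ∀ a y z → a * (y * z) ≡ y * a * z
  rearrange₂ = solve-∀

-- Climb `v` levels from level `j`. As the window has width at least `3 v`, each step multiplies the
-- coefficient by at least `(K + 2 v) / (K + v)`.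
C-low : ∀ {n} K w v → K + w + K ≡ n → v * 3 ≤ w → ∀ j → j < K →
  (n C j) * (K + v + v) ^ v ≤ (K + v) ^ v * centralBinom n
C-low {n} K w v eq 3v≤w j j<K = ≤-trans
  (C-growth n j (K + v + v) (K + v) v room (≤-trans (≤-reflexive (+-comm v j)) (+-monoˡ-≤ v (<⇒≤ j<K))))
  (*-monoʳ-≤ ((K + v) ^ v) (C≤central n (v + j) (≤-trans v+j≤ (≤-trans (m≤m+n _ K) (≤-reflexive eq)))))
  where
  open ≤-Reasoning
  v+j≤ : v + j ≤ K + w
  v+j≤ = ≤-trans (+-mono-≤ (≤-trans (m≤m*n v 3) 3v≤w) (<⇒≤ j<K)) (≤-reflexive (+-comm w K))
  identity : ∀ K v → K + v + v + (v + K) ≡ K + v * 3 + K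
  identity = solve-∀
  room : K + v + v + (v + j) ≤ suc n
  room = begin
    K + v + v + (v + j)  ≤⟨ +-monoʳ-≤ (K + v + v) (+-monoʳ-≤ v (<⇒≤ j<K)) ⟩
    K + v + v + (v + K)  ≡⟨ identity K v ⟩
    K + v * 3 + K        ≤⟨ +-monoˡ-≤ K (+-monoʳ-≤ K 3v≤w) ⟩
    K + w + K            ≡⟨ eq ⟩
    n                    ≤⟨ n≤1+n n ⟩
    suc n                ∎

-- Reflecting `j` to `n ∸ j` carries the levels above the window onto those below `K`.
C-high : ∀ {n} K w v → K + w + K ≡ n → v * 3 ≤ w → ∀ j → suc w + K ≤ j → j < K + (suc w + K) →
  (n C j) * (K + v + v) ^ v ≤ (K + v) ^ v * centralBinom n
C-high {n} K w v eq 3v≤w j lower upper =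
  subst (λ c → c * (K + v + v) ^ v ≤ (K + v) ^ v * centralBinom n) (sym (nCk≡nC[n∸k] j≤n))
    (C-low K w v eq 3v≤w (n ∸ j) (+-cancelʳ-< j (n ∸ j) K (begin-strict
      n ∸ j + j        ≡⟨ m∸n+n≡m j≤n ⟩
      n                <⟨ ≤-reflexive 1+n≡ ⟩
      K + (suc w + K)  ≤⟨ +-monoʳ-≤ K lower ⟩
      K + j            ∎)))
  where
  open ≤-Reasoning
  identity : ∀ K w → suc (K + w + K) ≡ K + (suc w + K)
  identity = solve-∀
  1+n≡ : suc n ≡ K + (suc w + K)
  1+n≡ = trans (cong suc (sym eq)) (identity K w)
  j≤n : j ≤ n
  j≤n = s≤s⁻¹ (≤-trans upper (≤-reflexive (sym 1+n≡)))

-- Sets whose difference is a singleton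

∣A─B∣≡0 : (A B : Subset n) → (∀ z → lookup A z ≡ inside → lookup B z ≡ inside) → ∣ A ─ B ∣ ≡ 0
∣A─B∣≡0 []            []            h = refl
∣A─B∣≡0 (_       ∷ A) (inside  ∷ B) h = ∣A─B∣≡0 A B (h ∘ suc)
∣A─B∣≡0 (outside ∷ A) (outside ∷ B) h = ∣A─B∣≡0 A B (h ∘ suc)
∣A─B∣≡0 (inside  ∷ A) (outside ∷ B) h with () ← h zero refl

∣A─B∣≡1 : (A B : Subset n) (x : Fin n) → lookup A x ≡ inside → lookup B x ≡ outside →
  (∀ z → z ≢ x → lookup A z ≡ inside → lookup B z ≡ inside) → ∣ A ─ B ∣ ≡ 1
∣A─B∣≡1 (inside ∷ A) (outside ∷ B) zero refl refl h =
  cong suc (∣A─B∣≡0 A B (λ z → h (suc z) (λ ())))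
∣A─B∣≡1 (_       ∷ A) (inside  ∷ B) (suc x) x∈A x∉B h =
  ∣A─B∣≡1 A B x x∈A x∉B (λ z z≢x → h (suc z) (λ where refl → z≢x refl))
∣A─B∣≡1 (outside ∷ A) (outside ∷ B) (suc x) x∈A x∉B h =
  ∣A─B∣≡1 A B x x∈A x∉B (λ z z≢x → h (suc z) (λ where refl → z≢x refl))
∣A─B∣≡1 (inside  ∷ A) (outside ∷ B) (suc x) x∈A x∉B h with () ← h zero (λ ()) refl

∉-⊹⇒≢ : (S : Subset n) (x z : Fin n) → lookup (S ⊹ x) z ≡ outside → z ≢ x
∉-⊹⇒≢ S x .x z∉ refl with () ← trans (sym z∉) (lookup∘update x S inside)

∉-⊹ : (S : Subset n) (x z : Fin n) → lookup (S ⊹ x) z ≡ outside → lookup S z ≡ outside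
∉-⊹ S x z z∉ = trans (sym (lookup∘update′ (∉-⊹⇒≢ S x z z∉) S inside)) z∉

∈-⊹ : (S : Subset n) (x z : Fin n) → lookup S z ≡ inside → lookup (S ⊹ x) z ≡ inside
∈-⊹ S x z z∈ with lookup (S ⊹ x) z in eq
... | inside  = refl
... | outside with () ← trans (sym z∈) (∉-⊹ S x z eq)

codim-⊹ : (S : Subset n) (x : Fin n) → lookup S x ≡ outside → codim S ≡ suc (codim (S ⊹ x))
codim-⊹ S x = sumOut-split S x (λ _ → 1)

-- Counting hits along upward walks

module Hits {n : ℕ} (χ : Subset n → ℕ) (χ≤1 : ∀ S → χ S ≤ 1)
            (separated : ∀ A B → χ A ≢ 0 → χ B ≢ 0 → ∣ A ─ B ∣ ≢ 1) where

  hits : Subset n → ℕ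
  hits S = sumOut S (λ z → χ (S ⊹ z))

  -- The state of a walk that was hit by x at A - x ⊆ S and has not added x since.
  Blocked : Subset n → Fin n → Set
  Blocked S x = lookup S x ≡ outside × ∃ λ A → χ A ≢ 0 × lookup A x ≡ inside ×
    (∀ z → z ≢ x → lookup A z ≡ inside → lookup S z ≡ inside)

  -- Only adding `x` itself ends the blocked state: as `S` grows it keeps containing `A` minus `x`.
  blocked-⊹ : ∀ S x z → lookup (S ⊹ x) z ≡ outside → Blocked S x → Blocked (S ⊹ z) x
  blocked-⊹ S x z z∉ (x∉S , A , A∈ , x∈A , A⊆S) =
    trans (lookup∘update′ (∉-⊹⇒≢ S x z z∉ ∘ sym) S inside) x∉S ,
    A , A∈ , x∈A , λ y y≢x y∈A → ∈-⊹ S z y (A⊆S y y≢x y∈A)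

  blocked-hit : ∀ S x → lookup S x ≡ outside → χ (S ⊹ x) ≢ 0 → Blocked S x
  blocked-hit S x x∉S S⊹x∈ = x∉S , S ⊹ x , S⊹x∈ , lookup∘update x S inside ,
    λ z z≢x z∈ → trans (sym (lookup∘update′ z≢x S inside)) z∈

  -- If some `z` other than `x` hit `S`, then `A ─ (S ⊹ z)` would be the singleton of `x`, which
  -- `separated` forbids.
  hits-blocked : ∀ S x → Blocked S x → hits S ≡ χ (S ⊹ x)
  hits-blocked S x (x∉S , A , A∈ , x∈A , A⊆S) = begin
    hits S                                           ≡⟨ sumOut-split S x _ x∉S ⟩
    χ (S ⊹ x) + sumOut (S ⊹ x) (λ z → χ (S ⊹ z))     ≡⟨ cong (χ (S ⊹ x) +_) none ⟩
    χ (S ⊹ x) + 0                                    ≡⟨ +-identityʳ _ ⟩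
    χ (S ⊹ x)                                        ∎
    where
    open ≡-Reasoning
    none : sumOut (S ⊹ x) (λ z → χ (S ⊹ z)) ≡ 0
    none with sumOut-zero? (S ⊹ x) (λ z → χ (S ⊹ z))
    ... | inj₁ eq = eq
    ... | inj₂ (z , z∉ , S⊹z∈) = contradiction
      (∣A─B∣≡1 A (S ⊹ z) x x∈A
        (trans (lookup∘update′ (∉-⊹⇒≢ S x z z∉ ∘ sym) S inside) x∉S)
        (λ y y≢x y∈A → ∈-⊹ S z y (A⊆S y y≢x y∈A)))
      (separated A (S ⊹ z) A∈ S⊹z∈)

  hits-zero? : ∀ S → hits S ≡ 0 ⊎ ∃ λ x → Blocked S x
  hits-zero? S with sumOut-zero? S (λ z → χ (S ⊹ z))
  ... | inj₁ eq                = inj₁ eq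
  ... | inj₂ (x , x∉S , S⊹x∈)  = inj₂ (x , blocked-hit S x x∉S S⊹x∈)

  -- A hit by `x` blocks `S` for all other elements, with `S ⊹ x` in the role of `A`.
  hits≤1 : ∀ S → hits S ≤ 1
  hits≤1 S with hits-zero? S
  ... | inj₁ eq      = ≤-trans (≤-reflexive eq) z≤n
  ... | inj₂ (x , b) = ≤-trans (≤-reflexive (hits-blocked S x b)) (χ≤1 (S ⊹ x))

  module Walk (N : ℕ) where

    -- The falling factorial (N + r) ⋯ (N + 1): ordered choices of `r` elements out of `N + r`.
    paths : ℕ → ℕ
    paths zero    = 1
    paths (suc r) = (N + suc r) * paths r

    -- For codim S = N + r: the hits summed over all paths r walks of r steps starting at S.
    walkHits : ℕ → Subset n → ℕ
    walkHits zero    S = hits S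
    walkHits (suc r) S = paths (suc r) * hits S + sumOut S (λ z → walkHits r (S ⊹ z))

    Bound : ℕ → Subset n → Set
    Bound r S = walkHits r S * N ^ r ≤ paths r * (N + 2) ^ r

    -- Bound minus paths r * N ^ r, except for the hit that S itself may give.
    BlockedBound : ℕ → Subset n → Fin n → Set
    BlockedBound r S x =
      walkHits r S * N ^ r + paths r * N ^ r ≤ paths r * (N + 2) ^ r + χ (S ⊹ x) * (paths r * N ^ r)

    codim-step : ∀ (S : Subset n) x r → lookup S x ≡ outside → codim S ≡ N + suc r → codim (S ⊹ x) ≡ N + r
    codim-step S x r x∉S eq =
      suc-injective (trans (sym (codim-⊹ S x x∉S)) (trans eq (+-suc N r)))

    blockedBound-zero : ∀ S x → Blocked S x → BlockedBound 0 S x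
    blockedBound-zero S x b rewrite hits-blocked S x b = ≤-reflexive (identity (χ (S ⊹ x)))
      where
      identity : ∀ c → c * 1 + 1 ≡ 1 + c * 1
      identity = solve-∀

    -- The hit at `S` is worth at most one `paths r * N ^ r`, exactly what the blocked bound saves.
    bound-from-blocked : ∀ r S x → BlockedBound r S x → Bound r S
    bound-from-blocked r S x bb = +-cancelʳ-≤ (paths r * N ^ r) _ _ (begin
      walkHits r S * N ^ r + paths r * N ^ r
        ≤⟨ bb ⟩
      paths r * (N + 2) ^ r + χ (S ⊹ x) * (paths r * N ^ r)
        ≤⟨ +-monoʳ-≤ _ (*-monoˡ-≤ (paths r * N ^ r) (χ≤1 (S ⊹ x))) ⟩
      paths r * (N + 2) ^ r + 1 * (paths r * N ^ r)
        ≡⟨ cong (paths r * (N + 2) ^ r +_) (*-identityˡ _) ⟩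
      paths r * (N + 2) ^ r + paths r * N ^ r ∎)
      where open ≤-Reasoning

    bound-step-free : ∀ r S → codim S ≡ N + suc r → hits S ≡ 0 →
      (∀ z → lookup S z ≡ outside → Bound r (S ⊹ z)) → Bound (suc r) S
    bound-step-free r S eq free bounds = begin
      (paths (suc r) * hits S + X) * (N * N ^ r)
        ≡⟨ cong (λ h → (paths (suc r) * h + X) * (N * N ^ r)) free ⟩
      (paths (suc r) * 0 + X) * (N * N ^ r)
        ≡⟨ rearrange₁ (paths (suc r)) X N (N ^ r) ⟩
      N * (X * N ^ r)
        ≡⟨ cong (N *_) (sumOut-*ʳ S _ (N ^ r)) ⟨
      N * sumOut S (λ z → walkHits r (S ⊹ z) * N ^ r)
        ≤⟨ *-monoʳ-≤ N (sumOut-mono S bounds) ⟩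
      N * sumOut S (λ _ → paths r * (N + 2) ^ r)
        ≡⟨ cong (N *_) (trans (sumOut-const S _) (cong (_* (paths r * (N + 2) ^ r)) eq)) ⟩
      N * ((N + suc r) * (paths r * (N + 2) ^ r))
        ≤⟨ *-monoˡ-≤ _ (m≤m+n N 2) ⟩
      (N + 2) * ((N + suc r) * (paths r * (N + 2) ^ r))
        ≡⟨ rearrange₂ (N + 2) (N + suc r) (paths r) ((N + 2) ^ r) ⟩
      (N + suc r) * paths r * ((N + 2) * (N + 2) ^ r) ∎
      where
      open ≤-Reasoning
      X = sumOut S (λ z → walkHits r (S ⊹ z))
      rearrange₁ : ∀ p x n q → (p * 0 + x) * (n * q) ≡ n * (x * q)
      rearrange₁ = solve-∀
      rearrange₂ : ∀ a b p q → a * (b * (p * q)) ≡ b * p * (a * q)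
      rearrange₂ = solve-∀

    -- Split on the next element. Adding `x` leaves only the plain bound; adding another `z` keeps
    -- the walk blocked by `x`, with a hit possible if `S ⊹ x ⊹ z` is in the family. Each
    -- possibility costs one `p * m`, and together they account for the 2 in `N + 2`.
    blockedBound-step : ∀ r S x → codim S ≡ N + suc r → Blocked S x → Bound r (S ⊹ x) →
      (∀ z → lookup (S ⊹ x) z ≡ outside → BlockedBound r (S ⊹ z) x) → BlockedBound (suc r) S x
    blockedBound-step r S x eq b@(x∉S , _) boundˣ bounds = begin
      (paths (suc r) * hits S + sumOut S (λ z → walkHits r (S ⊹ z))) * (N * N ^ r) + paths (suc r) * (N * N ^ r)
        ≡⟨ cong₂ (λ h y → (paths (suc r) * h + y) * (N * N ^ r) + paths (suc r) * (N * N ^ r))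
             (hits-blocked S x b) (sumOut-split S x _ x∉S) ⟩
      ((N + suc r) * p * c + (u + Y)) * (N * m) + (N + suc r) * p * (N * m)
        ≡⟨ rearrange₁ N r p c u Y m ⟩
      N * (u * m + (Y * m + (N + r) * (p * m)) + p * m) + c * ((N + suc r) * p * (N * m))
        ≤⟨ +-monoˡ-≤ _ (*-monoʳ-≤ N (+-monoˡ-≤ (p * m) (+-mono-≤ boundˣ others))) ⟩
      N * (p * q + ((N + r) * (p * q) + 1 * (p * m)) + p * m) + c * ((N + suc r) * p * (N * m))
        ≡⟨ rearrange₂ N r p q m c ⟩
      N * (N + suc r) * (p * q) + (2 * N) * (p * m) + c * ((N + suc r) * p * (N * m))
        ≤⟨ +-monoˡ-≤ _ (+-monoʳ-≤ (N * (N + suc r) * (p * q))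
             (*-mono-≤ (*-monoʳ-≤ 2 (m≤m+n N (suc r))) (*-monoʳ-≤ p (^-monoˡ-≤ r (m≤m+n N 2))))) ⟩
      N * (N + suc r) * (p * q) + (2 * (N + suc r)) * (p * q) + c * ((N + suc r) * p * (N * m))
        ≡⟨ rearrange₃ N (N + suc r) p q (c * ((N + suc r) * p * (N * m))) ⟩
      (N + suc r) * p * ((N + 2) * q) + c * ((N + suc r) * p * (N * m)) ∎
      where
      open ≤-Reasoning
      p = paths r
      m = N ^ r
      q = (N + 2) ^ r
      c = χ (S ⊹ x)
      u = walkHits r (S ⊹ x)
      Y = sumOut (S ⊹ x) (λ z → walkHits r (S ⊹ z))
      others : Y * m + (N + r) * (p * m) ≤ (N + r) * (p * q) + 1 * (p * m)
      others = begin
        Y * m + (N + r) * (p * m)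
          ≡⟨ cong₂ _+_ (sumOut-*ʳ (S ⊹ x) (λ z → walkHits r (S ⊹ z)) m)
               (trans (sumOut-const (S ⊹ x) (p * m)) (cong (_* (p * m)) (codim-step S x r x∉S eq))) ⟨
        sumOut (S ⊹ x) (λ z → walkHits r (S ⊹ z) * m) + sumOut (S ⊹ x) (λ _ → p * m)
          ≡⟨ sumOut-+ (S ⊹ x) _ _ ⟨
        sumOut (S ⊹ x) (λ z → walkHits r (S ⊹ z) * m + p * m)
          -- Since `S ⊹ z ⊹ x` equals `S ⊹ x ⊹ z`, the corrections summed over `z` amount to
          -- `hits (S ⊹ x)`, which is at most 1.
          ≤⟨ sumOut-mono (S ⊹ x) (λ z z∉ → subst (λ T → walkHits r (S ⊹ z) * m + p * m ≤ p * q + χ T * (p * m))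
               ([]≔-commutes S z x (∉-⊹⇒≢ S x z z∉)) (bounds z z∉)) ⟩
        sumOut (S ⊹ x) (λ z → p * q + χ (S ⊹ x ⊹ z) * (p * m))
          ≡⟨ sumOut-+ (S ⊹ x) _ _ ⟩
        sumOut (S ⊹ x) (λ _ → p * q) + sumOut (S ⊹ x) (λ z → χ (S ⊹ x ⊹ z) * (p * m))
          ≡⟨ cong₂ _+_ (trans (sumOut-const (S ⊹ x) (p * q)) (cong (_* (p * q)) (codim-step S x r x∉S eq)))
               (sumOut-*ʳ (S ⊹ x) _ (p * m)) ⟩
        (N + r) * (p * q) + hits (S ⊹ x) * (p * m)
          ≤⟨ +-monoʳ-≤ ((N + r) * (p * q)) (*-monoˡ-≤ (p * m) (hits≤1 (S ⊹ x))) ⟩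
        (N + r) * (p * q) + 1 * (p * m) ∎
      rearrange₁ : ∀ N r p c u Y m →
        ((N + suc r) * p * c + (u + Y)) * (N * m) + (N + suc r) * p * (N * m) ≡
        N * (u * m + (Y * m + (N + r) * (p * m)) + p * m) + c * ((N + suc r) * p * (N * m))
      rearrange₁ = solve-∀
      rearrange₂ : ∀ N r p q m c →
        N * (p * q + ((N + r) * (p * q) + 1 * (p * m)) + p * m) + c * ((N + suc r) * p * (N * m)) ≡
        N * (N + suc r) * (p * q) + (2 * N) * (p * m) + c * ((N + suc r) * p * (N * m))
      rearrange₂ = solve-∀
      rearrange₃ : ∀ N k p q d → N * k * (p * q) + (2 * k) * (p * q) + d ≡ k * p * ((N + 2) * q) + d
      rearrange₃ = solve-∀

    mutual
      -- Simultaneous induction on `r`: a hit at `S` passes to the blocked bound at the same `r`,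
      -- and every added element lowers `r`.
      bound : ∀ r S → codim S ≡ N + r → Bound r S
      bound r S eq with hits-zero? S
      bound r       S eq | inj₂ (x , b) = bound-from-blocked r S x (blockedBound r S x eq b)
      bound zero    S eq | inj₁ _       = *-monoˡ-≤ 1 (hits≤1 S)
      bound (suc r) S eq | inj₁ free    =
        bound-step-free r S eq free (λ z z∉ → bound r (S ⊹ z) (codim-step S z r z∉ eq))

      blockedBound : ∀ r S x → codim S ≡ N + r → Blocked S x → BlockedBound r S x
      blockedBound zero    S x eq b           = blockedBound-zero S x b
      blockedBound (suc r) S x eq b@(x∉S , _) = blockedBound-step r S x eq b
        (bound r (S ⊹ x) (codim-step S x r x∉S eq))
        (λ z z∉ → blockedBound r (S ⊹ z) x (codim-step S z r (∉-⊹ S x z z∉) eq) (blocked-⊹ S x z z∉ b))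

-- From walks to weighted level sizes

module LevelBounds {n : ℕ} (χ : Subset n → ℕ) (χ≤1 : ∀ S → χ S ≤ 1)
            (separated : ∀ A B → χ A ≢ 0 → χ B ≢ 0 → ∣ A ─ B ∣ ≢ 1) where

  open Hits χ χ≤1 separated

  level : ℕ → ℕ
  level i = sumLevel n i χ

  levelHits : ℕ → ℕ
  levelHits i = sumLevel n i hits

  levelHits≡ : ∀ i → levelHits i ≡ suc i * level (suc i)
  levelHits≡ i = sumLevel-sumOut n i χ

  level≤C : ∀ i → level i ≤ n C i
  level≤C i = ≤-trans (sumLevel-mono n i (λ S _ → χ≤1 S)) (≤-reflexive (sumLevel-1 n i))

  module _ (N : ℕ) where
    open Walk N

    -- The LYM step. A uniform walk from a random set of level `i` visits a given set of level `j`
    -- with probability `1 / (n C j)`, at least one over the central coefficient; multiplying by the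
    -- number `paths r * (n C i)` of walks clears denominators.
    hits≤walkHits : ∀ r i → N + r + i ≡ n →
      paths r * (n C i) * sumFrom levelHits i (suc r) ≤ sumLevel n i (walkHits r) * centralBinom n
    hits≤walkHits zero i eq = begin
      1 * (n C i) * (levelHits i + 0)     ≡⟨ rearrange (n C i) (levelHits i) ⟩
      levelHits i * (n C i)               ≤⟨ *-monoʳ-≤ (levelHits i) (C≤central n i (≤-trans (m≤n+m i (N + 0)) (≤-reflexive eq))) ⟩
      levelHits i * centralBinom n        ∎
      where
      open ≤-Reasoning
      rearrange : ∀ c l → 1 * c * (l + 0) ≡ l * c
      rearrange = solve-∀
    hits≤walkHits (suc r) i eq = begin
      p′ * c * (h + R)
        ≡⟨ rearrange₁ N r p c h R ⟩
      p′ * h * c + p * (c * (N + suc r)) * R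
        -- Walks of `suc r` steps from level `i` are regrouped by their second set, of level
        -- `suc i`.
        ≡⟨ cong (λ t → p′ * h * c + p * t * R) absorb ⟩
      p′ * h * c + p * (suc i * (n C suc i)) * R
        ≡⟨ rearrange₂ (p′ * h * c) p i (n C suc i) R ⟩
      p′ * h * c + suc i * (p * (n C suc i) * R)
        ≤⟨ +-mono-≤ (*-monoʳ-≤ (p′ * h) (C≤central n i (≤-trans (m≤n+m i (N + suc r)) (≤-reflexive eq))))
             (*-monoʳ-≤ (suc i) (hits≤walkHits r (suc i) (trans (shift N r i) eq))) ⟩
      p′ * h * M + suc i * (W * M)
        ≡⟨ rearrange₃ p′ h M (suc i) W ⟩
      (h * p′ + suc i * W) * M
        ≡⟨ cong (_* M) (cong₂ _+_ (sym (sumLevel-*ʳ n i hits p′)) (sym (sumLevel-sumOut n i (walkHits r)))) ⟩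
      (sumLevel n i (λ S → hits S * p′) + sumLevel n i (λ S → sumOut S (λ z → walkHits r (S ⊹ z)))) * M
        ≡⟨ cong (_* M) (sumLevel-+ n i _ _) ⟨
      sumLevel n i (λ S → hits S * p′ + sumOut S (λ z → walkHits r (S ⊹ z))) * M
        ≡⟨ cong (_* M) (sumLevel-cong n i (λ S _ → cong (_+ sumOut S (λ z → walkHits r (S ⊹ z))) (*-comm (hits S) p′))) ⟩
      sumLevel n i (walkHits (suc r)) * M ∎
      where
      open ≤-Reasoning
      p = paths r
      p′ = paths (suc r)
      c = n C i
      h = levelHits i
      R = sumFrom levelHits (suc i) (suc r)
      M = centralBinom n
      W = sumLevel n (suc i) (walkHits r)
      absorb : c * (N + suc r) ≡ suc i * (n C suc i)
      absorb = subst (λ k → (k C i) * (N + suc r) ≡ suc i * (k C suc i)) eq (absorption (N + suc r) i)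
      shift : ∀ a b c → a + b + suc c ≡ a + suc b + c
      shift = solve-∀
      rearrange₁ : ∀ N r p c h R → (N + suc r) * p * c * (h + R) ≡ (N + suc r) * p * h * c + p * (c * (N + suc r)) * R
      rearrange₁ = solve-∀
      rearrange₂ : ∀ a p i c R → a + p * (suc i * c) * R ≡ a + suc i * (p * c * R)
      rearrange₂ = solve-∀
      rearrange₃ : ∀ p h M i W → p * h * M + i * (W * M) ≡ (h * p + i * W) * M
      rearrange₃ = solve-∀

    paths-positive : ∀ r → 0 < paths r
    paths-positive zero    = s≤s z≤n
    paths-positive (suc r) rewrite +-suc N r = *-mono-≤ (s≤s (z≤n {N + r})) (paths-positive r)

    -- Adds `bound` over all starting sets of level `a` and cancels the number `paths w * (n C a)`
    -- of walks.
    sum-levelHits : ∀ w a → N + w + a ≡ n →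
      sumFrom levelHits a (suc w) * N ^ w ≤ (N + 2) ^ w * centralBinom n
    sum-levelHits w a eq = *-cancelˡ-≤ (paths w * (n C a)) (begin
      p * c * (R * N ^ w)                            ≡⟨ *-assoc (p * c) R (N ^ w) ⟨
      p * c * R * N ^ w                              ≤⟨ *-monoˡ-≤ (N ^ w) (hits≤walkHits w a eq) ⟩
      sumLevel n a (walkHits w) * M * N ^ w          ≡⟨ rearrange₁ (sumLevel n a (walkHits w)) M (N ^ w) ⟩
      sumLevel n a (walkHits w) * N ^ w * M          ≡⟨ cong (_* M) (sumLevel-*ʳ n a (walkHits w) (N ^ w)) ⟨
      sumLevel n a (λ S → walkHits w S * N ^ w) * M  ≤⟨ *-monoˡ-≤ M (sumLevel-mono n a (λ S eqS → bound w S (+-cancelʳ-≡ a _ _ (trans eqS (sym eq))))) ⟩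
      sumLevel n a (λ _ → p * (N + 2) ^ w) * M       ≡⟨ cong (_* M) (sumLevel-const n a (p * (N + 2) ^ w)) ⟩
      c * (p * (N + 2) ^ w) * M                      ≡⟨ rearrange₂ c p ((N + 2) ^ w) M ⟩
      p * c * ((N + 2) ^ w * M)                      ∎)
      where
      open ≤-Reasoning
      p = paths w
      c = n C a
      R = sumFrom levelHits a (suc w)
      M = centralBinom n
      instance
        pc-nonZero : NonZero (paths w * (n C a))
        pc-nonZero = >-nonZero (*-mono-≤ (paths-positive w) (subst (λ k → 0 < k C a) eq (C-positive (N + w) a)))
      rearrange₁ : ∀ a b c → a * b * c ≡ a * c * b
      rearrange₁ = solve-∀
      rearrange₂ : ∀ c p q M → c * (p * q) * M ≡ p * c * (q * M)
      rearrange₂ = solve-∀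

  -- A member of level `j` is counted `j` times by the hits one level below, and `j` is at least
  -- `suc a` on the window.
  middle-levels : ∀ a w → suc a + w + suc a ≡ n →
    suc a * sumFrom level (suc a) (suc w) * (2 + a) ^ w ≤ (2 + a + 2) ^ w * centralBinom n
  middle-levels a w eq = begin
    suc a * sumFrom level (suc a) (suc w) * (2 + a) ^ w
      ≤⟨ *-monoˡ-≤ ((2 + a) ^ w) (*-sumFrom-≤ level (suc a) (suc w)) ⟩
    sumFrom (λ j → j * level j) (suc a) (suc w) * (2 + a) ^ w
      ≡⟨ cong (_* (2 + a) ^ w) (trans (sumFrom-cong a (suc w) levelHits≡) (sumFrom-suc (λ j → j * level j) a (suc w))) ⟨
    sumFrom levelHits a (suc w) * (2 + a) ^ w
      -- Hits occur one level below the members, so the walk runs from level `a` to level `a + w`,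
      -- where `2 + a` elements are left.
      ≤⟨ sum-levelHits (2 + a) w a (trans (sym (+-suc (suc a + w) a)) eq) ⟩
    (2 + a + 2) ^ w * centralBinom n ∎
    where open ≤-Reasoning

-- Estimates for the window and the tails

-- Bernoulli's inequality (1 + v / y) ^ s ≥ 1 + s v / y, cleared of denominators.
bernoulli : ∀ y v s → y ^ s * (y + s * v) ≤ y * (y + v) ^ s
bernoulli y v zero    = ≤-reflexive (identity y)
  where
  identity : ∀ y → 1 * (y + 0) ≡ y * 1
  identity = solve-∀
bernoulli y v (suc s) = begin
  y * y ^ s * (y + (v + s * v))                   ≤⟨ m≤m+n _ (y ^ s * (s * v * v)) ⟩
  y * y ^ s * (y + (v + s * v)) + y ^ s * (s * v * v)  ≡⟨ rearrange₁ y (y ^ s) v s ⟩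
  y ^ s * (y + s * v) * (y + v)                   ≤⟨ *-monoˡ-≤ (y + v) (bernoulli y v s) ⟩
  y * (y + v) ^ s * (y + v)                       ≡⟨ rearrange₂ y ((y + v) ^ s) (y + v) ⟩
  y * ((y + v) * (y + v) ^ s)                     ∎
  where
  open ≤-Reasoning
  rearrange₁ : ∀ y p v s → y * p * (y + (v + s * v)) + p * (s * v * v) ≡ p * (y + s * v) * (y + v)
  rearrange₁ = solve-∀
  rearrange₂ : ∀ a b c → a * b * c ≡ a * (c * b)
  rearrange₂ = solve-∀

-- (1 - 2 / (q + 2)) ^ w ≥ 1 - 2 w / (q + 2), cleared of denominators and subtractions.
reverse-bernoulli : ∀ q w → (q + 2) ^ w * (q + 2) ≤ q ^ w * (q + 2) + 2 * w * (q + 2) ^ w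
reverse-bernoulli q zero    = m≤m+n _ _
reverse-bernoulli q (suc w) = begin
  (q + 2) * P * (q + 2)                                      ≡⟨ rearrange₁ q P ⟩
  q * (P * (q + 2)) + 2 * (P * (q + 2))                      ≤⟨ +-monoˡ-≤ _ (*-monoʳ-≤ q (reverse-bernoulli q w)) ⟩
  q * (p * (q + 2) + 2 * w * P) + 2 * (P * (q + 2))          ≤⟨ m≤m+n _ (4 * w * P) ⟩
  q * (p * (q + 2) + 2 * w * P) + 2 * (P * (q + 2)) + 4 * w * P ≡⟨ rearrange₂ q p P w ⟩
  q * p * (q + 2) + 2 * suc w * ((q + 2) * P)                ∎
  where
  open ≤-Reasoning
  p = q ^ w
  P = (q + 2) ^ w
  rearrange₁ : ∀ q P → (q + 2) * P * (q + 2) ≡ q * (P * (q + 2)) + 2 * (P * (q + 2))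
  rearrange₁ = solve-∀
  rearrange₂ : ∀ q p P w → q * (p * (q + 2) + 2 * w * P) + 2 * (P * (q + 2)) + 4 * w * P ≡
    q * p * (q + 2) + 2 * suc w * ((q + 2) * P)
  rearrange₂ = solve-∀

-- Bernoulli gives (1 + 3s/y)^s ≥ s²/y; the cube s^6/y^3 has a high enough degree to beat the factor
-- n^5 in the tails.
bernoulli-cubed : ∀ y s → y ^ (s * 3) * s ^ 6 ≤ y ^ 3 * (y + s * 3) ^ (s * 3)
bernoulli-cubed y s = begin
  y ^ (s * 3) * s ^ 6                              ≡⟨ cong (_* s ^ 6) (^-*-assoc y s 3) ⟨
  (y ^ s) ^ 3 * s ^ 6                              ≡⟨ rearrange₁ (y ^ s) s ⟩
  (y ^ s * (s * s)) ^ 3                            ≤⟨ ^-monoˡ-≤ 3 (*-monoʳ-≤ (y ^ s) (≤-trans (*-monoʳ-≤ s (m≤m*n s 3)) (m≤n+m _ y))) ⟩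
  (y ^ s * (y + s * (s * 3))) ^ 3                  ≤⟨ ^-monoˡ-≤ 3 (bernoulli y (s * 3) s) ⟩
  (y * (y + s * 3) ^ s) ^ 3                        ≡⟨ rearrange₂ y ((y + s * 3) ^ s) ⟩
  y ^ 3 * ((y + s * 3) ^ s) ^ 3                    ≡⟨ cong (y ^ 3 *_) (^-*-assoc (y + s * 3) s 3) ⟩
  y ^ 3 * (y + s * 3) ^ (s * 3)                    ∎
  where
  open ≤-Reasoning
  rearrange₁ : ∀ p s → (p * (p * (p * 1))) * (s * (s * (s * (s * (s * (s * 1)))))) ≡
    ((p * (s * s)) * ((p * (s * s)) * ((p * (s * s)) * 1)))
  rearrange₁ = solve-∀
  rearrange₂ : ∀ y q → ((y * q) * ((y * q) * ((y * q) * 1))) ≡ (y * (y * (y * 1))) * (q * (q * (q * 1)))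
  rearrange₂ = solve-∀

-- The fifth power collects `n` itself, `K ≤ n` from the number of tail levels, and `y ^ 3` from
-- `bernoulli-cubed`.
tail-arithmetic : ∀ e n K y s L M → 1 ≤ y → 1 ≤ s → K ≤ n → y ≤ n → 4 * e * n ^ 5 ≤ s ^ 6 →
  L * (y + s * 3) ^ (s * 3) ≤ (K + K) * (y ^ (s * 3) * M) → 2 * e * n * L ≤ M
tail-arithmetic e n K y s L M 1≤y 1≤s K≤n y≤n small tail = *-cancelʳ-≤ _ _ (Y * s ^ 6) (begin
  2 * e * n * L * (Y * s ^ 6)                 ≤⟨ *-monoʳ-≤ (2 * e * n * L) (bernoulli-cubed y s) ⟩
  2 * e * n * L * (y ^ 3 * X)                 ≡⟨ rearrange₁ (2 * e * n) L (y ^ 3) X ⟩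
  2 * e * n * y ^ 3 * (L * X)                 ≤⟨ *-monoʳ-≤ (2 * e * n * y ^ 3) tail ⟩
  2 * e * n * y ^ 3 * ((K + K) * (Y * M))     ≡⟨ rearrange₂ e n (y ^ 3) K (Y * M) ⟩
  4 * e * (n * (K * y ^ 3)) * (Y * M)         ≤⟨ *-monoˡ-≤ (Y * M) (*-monoʳ-≤ (4 * e) (*-monoʳ-≤ n (*-mono-≤ K≤n (^-monoˡ-≤ 3 y≤n)))) ⟩
  4 * e * n ^ 5 * (Y * M)                     ≤⟨ *-monoˡ-≤ (Y * M) small ⟩
  s ^ 6 * (Y * M)                             ≡⟨ rearrange₃ (s ^ 6) Y M ⟩
  M * (Y * s ^ 6)                             ∎)
  where
  open ≤-Reasoning
  X = (y + s * 3) ^ (s * 3)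
  Y = y ^ (s * 3)
  instance
    y-nonZero : NonZero y
    y-nonZero = >-nonZero 1≤y
    s-nonZero : NonZero s
    s-nonZero = >-nonZero 1≤s
    Ys-nonZero : NonZero (y ^ (s * 3) * s ^ 6)
    Ys-nonZero = m*n≢0 _ _ {{m^n≢0 y (s * 3)}} {{m^n≢0 s 6}}
  rearrange₁ : ∀ a L b X → a * L * (b * X) ≡ a * b * (L * X)
  rearrange₁ = solve-∀
  rearrange₂ : ∀ e n y K Z → 2 * e * n * y * ((K + K) * Z) ≡ 4 * e * (n * (K * y)) * Z
  rearrange₂ = solve-∀
  rearrange₃ : ∀ a Y M → a * (Y * M) ≡ M * (Y * a)
  rearrange₃ = solve-∀

-- Expanding the left side gives `4 e K t` plus terms with a factor `e w`. Scaled by 24 these are at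
-- most 22 `K t`, which fits into 24 `K t`.
middle-room : ∀ e K w t → K ≤ 2 * t → w ≤ t → 24 * (e * w) ≤ K →
  2 * e * (K + w + K) * (t + 2 * w) ≤ (4 * e + 1) * (K * t)
middle-room e K w t K≤2t w≤t small = *-cancelˡ-≤ 24 (begin
  24 * (2 * e * (K + w + K) * (t + 2 * w))
    ≡⟨ rearrange₁ e K w t ⟩
  96 * e * (K * t) + (8 * K + 2 * t + 4 * w) * (24 * (e * w))
    ≤⟨ +-monoʳ-≤ (96 * e * (K * t)) (*-mono-≤ (+-mono-≤ (+-monoˡ-≤ (2 * t) (*-monoʳ-≤ 8 K≤2t)) (*-monoʳ-≤ 4 w≤t)) small) ⟩
  96 * e * (K * t) + (8 * (2 * t) + 2 * t + 4 * t) * K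
    ≤⟨ m≤m+n _ (2 * t * K) ⟩
  96 * e * (K * t) + (8 * (2 * t) + 2 * t + 4 * t) * K + 2 * t * K
    ≡⟨ rearrange₂ e K t ⟩
  24 * ((4 * e + 1) * (K * t)) ∎)
  where
  open ≤-Reasoning
  rearrange₁ : ∀ e K w t → 24 * (2 * e * (K + w + K) * (t + 2 * w)) ≡
    96 * e * (K * t) + (8 * K + 2 * t + 4 * w) * (24 * (e * w))
  rearrange₁ = solve-∀
  rearrange₂ : ∀ e K t → 96 * e * (K * t) + (8 * (2 * t) + 2 * t + 4 * t) * K + 2 * t * K ≡
    24 * ((4 * e + 1) * (K * t))
  rearrange₂ = solve-∀

-- By `reverse-bernoulli` the walk factor `(G / q) ^ w` is at most `G / t` with `t = G - 2 w`;
-- `middle-room` absorbs this loss and the difference between `2 K` and `n`.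
middle-arithmetic : ∀ e a w L M → 1 ≤ e → 24 * (e * w) ≤ suc a →
  suc a * L * (2 + a) ^ w ≤ (2 + a + 2) ^ w * M → 2 * e * (suc a + w + suc a) * L ≤ (4 * e + 1) * M
middle-arithmetic e a w L M 1≤e small middle =
  *-cancelʳ-≤ _ _ (K * t * G) (begin
    2 * e * k * L * (K * t * G)          ≡⟨ rearrange₁ (2 * e * k) L K t G ⟩
    2 * e * k * G * (K * L * t)          ≤⟨ *-mono-≤ room KLt≤GM ⟩
    (4 * e + 1) * (K * t) * (G * M)      ≡⟨ rearrange₂ (4 * e + 1) (K * t) G M ⟩
    (4 * e + 1) * M * (K * t * G)        ∎)
  where
  open ≤-Reasoning
  K = suc a
  k = K + w + K
  q = 2 + a
  G = q + 2
  u = K ∸ 4 * w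
  -- This is `G - 2 w` without subtraction, headed by `suc` so that it is visibly nonzero.
  t = suc (2 * w + u + 2)
  4w≤K : 4 * w ≤ suc a
  4w≤K = begin
    4 * w          ≤⟨ *-mono-≤ {4} {24} (≤ᵇ⇒≤ 4 24 _) (m≤n*m w e {{>-nonZero 1≤e}}) ⟩
    24 * (e * w)   ≤⟨ small ⟩
    suc a          ∎
  eq : u + 4 * w ≡ K
  eq = m∸n+n≡m 4w≤K
  G≡t+2w : G ≡ t + 2 * w
  G≡t+2w = trans (cong (λ j → suc j + 2) (sym eq)) (identity u w)
    where
    identity : ∀ u w → suc (u + 4 * w) + 2 ≡ suc (2 * w + u + 2) + 2 * w
    identity = solve-∀
  room : 2 * e * k * G ≤ (4 * e + 1) * (K * t)
  room = subst (λ g → 2 * e * k * g ≤ (4 * e + 1) * (K * t)) (sym G≡t+2w)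
    (middle-room e K w t K≤2t w≤t small)
    where
    identity : ∀ u w → u + 4 * w + (u + 6) ≡ 2 * suc (2 * w + u + 2)
    identity = solve-∀
    K≤2t : K ≤ 2 * t
    K≤2t = subst (_≤ 2 * t) eq (≤-trans (m≤m+n (u + 4 * w) (u + 6)) (≤-reflexive (identity u w)))
    w≤t : w ≤ t
    w≤t = ≤-trans (m≤n*m w 2) (≤-trans (m≤m+n (2 * w) u) (≤-trans (m≤m+n _ 2) (n≤1+n _)))
  Pt≤pG : G ^ w * t ≤ q ^ w * G
  Pt≤pG = +-cancelʳ-≤ (2 * w * G ^ w) _ _ (begin
    G ^ w * t + 2 * w * G ^ w     ≡⟨ rearrange (G ^ w) t w ⟩
    G ^ w * (t + 2 * w)           ≡⟨ cong (G ^ w *_) G≡t+2w ⟨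
    G ^ w * G                     ≤⟨ reverse-bernoulli q w ⟩
    q ^ w * G + 2 * w * G ^ w     ∎)
    where
    rearrange : ∀ P t w → P * t + 2 * w * P ≡ P * (t + 2 * w)
    rearrange = solve-∀
  KLt≤GM : K * L * t ≤ G * M
  KLt≤GM = *-cancelʳ-≤ _ _ (q ^ w) {{m^n≢0 q w}} (begin
    K * L * t * q ^ w      ≡⟨ swap (K * L) t (q ^ w) ⟩
    K * L * q ^ w * t      ≤⟨ *-monoˡ-≤ t middle ⟩
    G ^ w * M * t          ≡⟨ swap (G ^ w) M t ⟩
    G ^ w * t * M          ≤⟨ *-monoˡ-≤ M Pt≤pG ⟩
    q ^ w * G * M          ≡⟨ rotate (q ^ w) G M ⟩
    G * M * q ^ w          ∎)
    where
    swap : ∀ a b c → a * b * c ≡ a * c * b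
    swap = solve-∀
    rotate : ∀ a b c → a * b * c ≡ b * c * a
    rotate = solve-∀
  rearrange₁ : ∀ a L K t G → a * L * (K * t * G) ≡ a * G * (K * L * t)
  rearrange₁ = solve-∀
  rearrange₂ : ∀ a b G M → a * b * (G * M) ≡ a * M * (b * G)
  rearrange₂ = solve-∀

-- All levels together

module TotalBounds {n : ℕ} (χ : Subset n → ℕ) (χ≤1 : ∀ S → χ S ≤ 1)
            (separated : ∀ A B → χ A ≢ 0 → χ B ≢ 0 → ∣ A ─ B ∣ ≢ 1) where

  open LevelBounds χ χ≤1 separated

  total : ℕ
  total = sumFrom level 0 (suc n)

  total≤ : total ≤ suc n * centralBinom n
  total≤ = subst (_≤ suc n * centralBinom n) (*-identityʳ total)
    (sumFrom-scaled-≤ level 0 (suc n) 1 (centralBinom n) (λ j _ j<1+n →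
      ≤-trans (≤-reflexive (*-identityʳ (level j))) (≤-trans (level≤C j)
        (C≤central n j (s≤s⁻¹ (subst (j <_) (+-identityʳ (suc n)) j<1+n))))))

  -- The window consists of `suc w` levels, with `K` levels on either side. After multiplying by
  -- `2 n e`, the tails contribute at most one central coefficient and the window at most `4 e + 1`.
  total-bound : ∀ e a w s → suc a + w + suc a ≡ n → 1 ≤ e → 1 ≤ s → s * 3 * 3 ≤ w →
    24 * (e * w) ≤ suc a → 4 * e * n ^ 5 ≤ s ^ 6 → total * n * e ≤ (2 * e + 1) * centralBinom n
  total-bound e a w s eq 1≤e 1≤s 9s≤w small₁ small₂ = *-cancelˡ-≤ 2 (begin
    2 * (total * n * e)                          ≡⟨ cong (λ t → 2 * (t * n * e)) split ⟩
    2 * ((low + (mid + high)) * n * e)           ≡⟨ rearrange₁ low mid high n e ⟩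
    2 * e * n * (low + high) + 2 * e * n * mid   ≤⟨ +-mono-≤ tails middle ⟩
    M + (4 * e + 1) * M                          ≡⟨ rearrange₂ e M ⟩
    2 * ((2 * e + 1) * M)                        ∎)
    where
    open ≤-Reasoning
    K = suc a
    M = centralBinom n
    -- Each tail level is compared with one `v` steps inwards; `s * 3 * 3 ≤ w` supplies the room of
    -- `3 v`.
    v = s * 3
    low  = sumFrom level 0 K
    mid  = sumFrom level K (suc w)
    high = sumFrom level (suc w + K) K
    identity : ∀ K w → suc (K + w + K) ≡ K + (suc w + K)
    identity = solve-∀
    split : total ≡ low + (mid + high)
    split = trans (cong (sumFrom level 0) (trans (cong suc (sym eq)) (identity K w)))
      (trans (sumFrom-+ level 0 K (suc w + K))
        (cong (low +_) (trans (cong (λ i → sumFrom level i (suc w + K)) (+-identityʳ K))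
          (sumFrom-+ level K (suc w) K))))
    rearrange₁ : ∀ l m h n e → 2 * ((l + (m + h)) * n * e) ≡ 2 * e * n * (l + h) + 2 * e * n * m
    rearrange₁ = solve-∀
    rearrange₂ : ∀ e M → M + (4 * e + 1) * M ≡ 2 * ((2 * e + 1) * M)
    rearrange₂ = solve-∀
    K≤n : K ≤ n
    K≤n = ≤-trans (m≤n+m K (K + w)) (≤-reflexive eq)
    K+v≤n : K + v ≤ n
    K+v≤n = ≤-trans (+-monoʳ-≤ K (≤-trans (m≤m*n v 3) 9s≤w)) (≤-trans (m≤m+n (K + w) K) (≤-reflexive eq))
    tails : 2 * e * n * (low + high) ≤ M
    tails = tail-arithmetic e n K (K + v) s (low + high) M (s≤s z≤n) 1≤s K≤n K+v≤n small₂ (begin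
      (low + high) * (K + v + v) ^ v
        ≡⟨ *-distribʳ-+ ((K + v + v) ^ v) low high ⟩
      low * (K + v + v) ^ v + high * (K + v + v) ^ v
        ≤⟨ +-mono-≤
             (sumFrom-scaled-≤ level 0 K ((K + v + v) ^ v) ((K + v) ^ v * M) (λ j _ j<K →
               ≤-trans (*-monoˡ-≤ ((K + v + v) ^ v) (level≤C j)) (C-low K w v eq 9s≤w j (subst (j <_) (+-identityʳ K) j<K))))
             (sumFrom-scaled-≤ level (suc w + K) K ((K + v + v) ^ v) ((K + v) ^ v * M) (λ j lower upper →
               ≤-trans (*-monoˡ-≤ ((K + v + v) ^ v) (level≤C j)) (C-high K w v eq 9s≤w j lower upper))) ⟩
      K * ((K + v) ^ v * M) + K * ((K + v) ^ v * M)
        ≡⟨ *-distribʳ-+ ((K + v) ^ v * M) K K ⟨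
      (K + K) * ((K + v) ^ v * M) ∎)
    middle : 2 * e * n * mid ≤ (4 * e + 1) * M
    middle = subst (λ k → 2 * e * k * mid ≤ (4 * e + 1) * M) eq
      (middle-arithmetic e a w mid M 1≤e small₁ (middle-levels a w eq))

-- Families as multiplicity functions

_≟ₛ_ : DecidableEquality (Subset n)
_≟ₛ_ = ≡-dec Bool._≟_

δ : Subset n → Subset n → ℕ
δ A S = if does (A ≟ₛ S) then 1 else 0

-- For a duplicate-free list this is the indicator function of the family, used as `χ` in the walk
-- argument.
multiplicity : List (Subset n) → Subset n → ℕ
multiplicity []      S = 0
multiplicity (A ∷ 𝒜) S = δ A S + multiplicity 𝒜 S

multiplicity≢0⇒∈ : (𝒜 : List (Subset n)) (S : Subset n) → multiplicity 𝒜 S ≢ 0 → S ∈ 𝒜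
multiplicity≢0⇒∈ []      S ≢0 = contradiction refl ≢0
multiplicity≢0⇒∈ (A ∷ 𝒜) S ≢0 with A ≟ₛ S
... | yes A≡S = here (sym A≡S)
... | no  _   = there (multiplicity≢0⇒∈ 𝒜 S ≢0)

multiplicity≤1 : (𝒜 : List (Subset n)) → Unique 𝒜 → ∀ S → multiplicity 𝒜 S ≤ 1
multiplicity≤1 []      []             S = z≤n
multiplicity≤1 (A ∷ 𝒜) (A∉𝒜 ∷ unique) S with A ≟ₛ S
... | no  _    = multiplicity≤1 𝒜 unique S
... | yes refl with multiplicity 𝒜 A ≟ 0
...   | yes eq = s≤s (≤-reflexive eq)
...   | no  ≢0 = contradiction refl (All.lookup A∉𝒜 (multiplicity≢0⇒∈ 𝒜 A ≢0))

δ-self : (A : Subset n) → δ A A ≡ 1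
δ-self A with A ≟ₛ A
... | yes _ = refl
... | no ≢  = contradiction refl ≢

-- Each entry `A` contributes 1 at its own level `∣ A ∣`, which is in range because `∣ A ∣ ≤ n`.
length≤total : ∀ {n} (𝒜 : List (Subset n)) →
  length 𝒜 ≤ sumFrom (λ i → sumLevel n i (multiplicity 𝒜)) 0 (suc n)
length≤total []          = z≤n
length≤total {n} (A ∷ 𝒜) = begin
  1 + length 𝒜
    ≤⟨ +-mono-≤ one (length≤total 𝒜) ⟩
  sumFrom (λ i → sumLevel n i (δ A)) 0 (suc n) + sumFrom (λ i → sumLevel n i (multiplicity 𝒜)) 0 (suc n)
    ≡⟨ sumFrom-distrib-+ (λ i → sumLevel n i (δ A)) (λ i → sumLevel n i (multiplicity 𝒜)) 0 (suc n) ⟨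
  sumFrom (λ i → sumLevel n i (δ A) + sumLevel n i (multiplicity 𝒜)) 0 (suc n)
    ≡⟨ sumFrom-cong 0 (suc n) (λ i → sumLevel-+ n i (δ A) (multiplicity 𝒜)) ⟨
  sumFrom (λ i → sumLevel n i (multiplicity (A ∷ 𝒜))) 0 (suc n) ∎
  where
  open ≤-Reasoning
  one : 1 ≤ sumFrom (λ i → sumLevel n i (δ A)) 0 (suc n)
  one = begin
    1                           ≡⟨ δ-self A ⟨
    δ A A                       ≤⟨ term≤sumLevel A (δ A) ⟩
    sumLevel n ∣ A ∣ (δ A)      ≡⟨ cong (λ i → sumLevel n i (δ A)) (+-identityʳ ∣ A ∣) ⟨
    sumLevel n (∣ A ∣ + 0) (δ A) ≤⟨ term≤sumFrom (λ i → sumLevel n i (δ A)) 0 (suc n) ∣ A ∣ (s≤s (∣p∣≤n A)) ⟩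
    sumFrom (λ i → sumLevel n i (δ A)) 0 (suc n) ∎

-- Bounds for the family and choice of the window

module _ {n : ℕ} (𝒜 : List (Subset n)) (unique : Unique 𝒜) (noDiffOne : NoDiffOne 𝒜) where

  open TotalBounds (multiplicity 𝒜) (multiplicity≤1 𝒜 unique)
    (λ A B A∈ B∈ → noDiffOne A B (multiplicity≢0⇒∈ 𝒜 A A∈) (multiplicity≢0⇒∈ 𝒜 B B∈))

  length-crude : length 𝒜 ≤ suc n * centralBinom n
  length-crude = ≤-trans (length≤total 𝒜) total≤

  length-bound-window : ∀ e K w s → K + w + K ≡ n → 1 ≤ e → 1 ≤ s → s * 3 * 3 ≤ w → 1 ≤ K →
    24 * (e * w) ≤ K → 4 * e * n ^ 5 ≤ s ^ 6 → length 𝒜 * n * e ≤ (2 * e + 1) * centralBinom n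
  length-bound-window e (suc a) w s eq 1≤e 1≤s 9s≤w _ small₁ small₂ = ≤-trans
    (*-monoˡ-≤ e (*-monoˡ-≤ n (length≤total 𝒜)))
    (total-bound e a w s eq 1≤e 1≤s 9s≤w small₁ small₂)

  -- The window has width about 9 n / D around n / 2, where D = 490 e; this is narrow enough for the
  -- middle levels, and n ≥ s₀ D makes n / D large enough for the tails.
  -- D and s₀ enter through equations so that these large numerals are never unfolded.
  length-bound : ∀ e D s₀ .{{_ : NonZero D}} → 1 ≤ e → D ≡ 490 * e → s₀ ≡ suc (4 * e * (2 * D) ^ 5) →
    s₀ * D ≤ n → length 𝒜 * n * e ≤ (2 * e + 1) * centralBinom n
  length-bound e D s₀ 1≤e D≡ s₀≡ large =
    length-bound-window e K w s K+w+K≡n 1≤e 1≤s (m≤m+n _ (m % 2)) 1≤K small₁ small₂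
    where
    open ≤-Reasoning
    s = n / D
    m = n ∸ s * 3 * 3
    K = m / 2
    -- The parity of `m` goes into the window, so that both sides have exactly `K` levels.
    w = s * 3 * 3 + m % 2
    s₀≤s : s₀ ≤ s
    s₀≤s = subst (_≤ s) (m*n/n≡m s₀ D) (/-monoˡ-≤ D large)
    s-large : 4 * e * (2 * D) ^ 5 < s
    s-large = subst (_≤ s) s₀≡ s₀≤s
    1≤s : 1 ≤ s
    1≤s = ≤-trans (s≤s z≤n) s-large
    sD≤n : s * (490 * e) ≤ n
    sD≤n = subst (λ d → s * d ≤ n) D≡ (m/n*n≤m n D)
    -- As `w ≤ 10 * s`, the middle estimate asks for `K` at least `240 * (s * e)`; this counts twice
    -- in `n = 2 K + w`, and the remaining `10 * (s * e)` covers `w`.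
    split490 : ∀ s e → s * (490 * e) ≡ 2 * (240 * (s * e)) + 10 * (s * e)
    split490 = solve-∀
    10s≤10se : 10 * s ≤ 10 * (s * e)
    10s≤10se = *-monoʳ-≤ 10 (m≤m*n s e {{>-nonZero 1≤e}})
    9s≤n : s * 3 * 3 ≤ n
    9s≤n = begin
      s * 3 * 3           ≤⟨ m≤m+n _ s ⟩
      s * 3 * 3 + s       ≡⟨ identity s ⟩
      10 * s              ≤⟨ 10s≤10se ⟩
      10 * (s * e)        ≤⟨ m≤n+m _ (2 * (240 * (s * e))) ⟩
      2 * (240 * (s * e)) + 10 * (s * e) ≡⟨ split490 s e ⟨
      s * (490 * e)       ≤⟨ sD≤n ⟩
      n                   ∎
      where
      identity : ∀ s → s * 3 * 3 + s ≡ 10 * s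
      identity = solve-∀
    K+w+K≡n : K + w + K ≡ n
    K+w+K≡n = begin-equality
      K + (s * 3 * 3 + m % 2) + K    ≡⟨ identity K (s * 3 * 3) (m % 2) ⟩
      (m % 2 + K * 2) + s * 3 * 3    ≡⟨ cong (_+ s * 3 * 3) (m≡m%n+[m/n]*n m 2) ⟨
      m + s * 3 * 3                  ≡⟨ m∸n+n≡m 9s≤n ⟩
      n                              ∎
      where
      identity : ∀ K a b → K + (a + b) + K ≡ (b + K * 2) + a
      identity = solve-∀
    w≤10s : w ≤ 10 * s
    w≤10s = ≤-trans (+-monoʳ-≤ (s * 3 * 3) (≤-trans (s≤s⁻¹ (m%n<n m 2)) 1≤s)) (≤-reflexive (identity s))
      where
      identity : ∀ s → s * 3 * 3 + s ≡ 10 * s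
      identity = solve-∀
    K-large : 240 * (s * e) ≤ K
    K-large = *-cancelˡ-≤ 2 (+-cancelʳ-≤ (10 * (s * e)) _ _ (begin
      2 * (240 * (s * e)) + 10 * (s * e)  ≡⟨ split490 s e ⟨
      s * (490 * e)                       ≤⟨ sD≤n ⟩
      n                                   ≡⟨ K+w+K≡n ⟨
      K + w + K                           ≡⟨ identity K w ⟩
      2 * K + w                           ≤⟨ +-monoʳ-≤ (2 * K) (≤-trans w≤10s 10s≤10se) ⟩
      2 * K + 10 * (s * e)                ∎))
      where
      identity : ∀ K w → K + w + K ≡ 2 * K + w
      identity = solve-∀
    1≤K : 1 ≤ K
    1≤K = ≤-trans (*-mono-≤ {1} {240} (s≤s z≤n) (*-mono-≤ 1≤s 1≤e)) K-large
    small₁ : 24 * (e * w) ≤ K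
    small₁ = begin
      24 * (e * w)         ≤⟨ *-monoʳ-≤ 24 (*-monoʳ-≤ e w≤10s) ⟩
      24 * (e * (10 * s))  ≡⟨ identity e s ⟩
      240 * (s * e)        ≤⟨ K-large ⟩
      K                    ∎
      where
      identity : ∀ e s → 24 * (e * (10 * s)) ≡ 240 * (s * e)
      identity = solve-∀
    n≤2Ds : n ≤ 2 * D * s
    n≤2Ds = begin
      n                ≡⟨ m≡m%n+[m/n]*n n D ⟩
      n % D + s * D    ≤⟨ +-monoˡ-≤ (s * D) (≤-trans (<⇒≤ (m%n<n n D)) (m≤n*m D s {{>-nonZero 1≤s}})) ⟩
      s * D + s * D    ≡⟨ identity s D ⟩
      2 * D * s        ∎
      where
      identity : ∀ s D → s * D + s * D ≡ 2 * D * s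
      identity = solve-∀
    -- After `n ≤ 2 * D * s` only the constant `4 * e * (2 * D) ^ 5` has to be beaten by one factor
    -- `s`; this dictates `s₀`.
    small₂ : 4 * e * n ^ 5 ≤ s ^ 6
    small₂ = begin
      4 * e * n ^ 5                ≤⟨ *-monoʳ-≤ (4 * e) (^-monoˡ-≤ 5 n≤2Ds) ⟩
      4 * e * (2 * D * s) ^ 5      ≡⟨ identity (4 * e) (2 * D) s ⟩
      4 * e * (2 * D) ^ 5 * s ^ 5  ≤⟨ *-monoˡ-≤ (s ^ 5) (<⇒≤ s-large) ⟩
      s ^ 6                        ∎
      where
      identity : ∀ a x s → a * (x * s * (x * s * (x * s * (x * s * (x * s * 1))))) ≡
        a * (x * (x * (x * (x * (x * 1))))) * (s * (s * (s * (s * (s * 1)))))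
      identity = solve-∀

-- The error term

toℚᵘ-/ : ∀ p d → ℚ.toℚᵘ ((ℤ.+ p) ℚ./ suc d) ℚᵘ.≃ mkℚᵘ (ℤ.+ p) d
toℚᵘ-/ p d = ℚ.toℚᵘ-fromℚᵘ (mkℚᵘ (ℤ.+ p) d)

-- In unnormalised rationals both sides are explicit fractions, so cross-multiplication reduces the
-- claim to naturals.
≤-from-ℕ : ∀ x p d M → x * suc d ≤ (2 * suc d + p) * M →
  toℚ x ℚ.≤ (toℚ 2 ℚ.+ (ℤ.+ p) ℚ./ suc d) ℚ.* toℚ M
≤-from-ℕ x p d M le = ℚ.toℚᵘ-cancel-≤ (begin
  ℚ.toℚᵘ (toℚ x)                                              ≃⟨ toℚᵘ-/ x 0 ⟩
  mkℚᵘ (ℤ.+ x) 0                                                ≤⟨ ℚᵘ.*≤* cross ⟩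
  (mkℚᵘ (ℤ.+ 2) 0 ℚᵘ.+ mkℚᵘ (ℤ.+ p) d) ℚᵘ.* mkℚᵘ (ℤ.+ M) 0          ≃⟨ ℚᵘ.*-cong (ℚᵘ.+-cong (toℚᵘ-/ 2 0) (toℚᵘ-/ p d)) (toℚᵘ-/ M 0) ⟨
  (ℚ.toℚᵘ (toℚ 2) ℚᵘ.+ ℚ.toℚᵘ ((ℤ.+ p) ℚ./ suc d)) ℚᵘ.* ℚ.toℚᵘ (toℚ M)
    ≃⟨ ℚᵘ.*-congʳ (ℚ.toℚᵘ-homo-+ (toℚ 2) ((ℤ.+ p) ℚ./ suc d)) ⟨
  ℚ.toℚᵘ (toℚ 2 ℚ.+ (ℤ.+ p) ℚ./ suc d) ℚᵘ.* ℚ.toℚᵘ (toℚ M)      ≃⟨ ℚ.toℚᵘ-homo-* (toℚ 2 ℚ.+ (ℤ.+ p) ℚ./ suc d) (toℚ M) ⟨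
  ℚ.toℚᵘ ((toℚ 2 ℚ.+ (ℤ.+ p) ℚ./ suc d) ℚ.* toℚ M)              ∎)
  where
  open ℚᵘ.≤-Reasoning
  lhs : ∀ d → (d + 0) * 1 ≡ d
  lhs = solve-∀
  rhs : ∀ d p M → (2 * d + p * 1) * M * 1 ≡ (2 * d + p) * M
  rhs = solve-∀
  cross : (ℤ.+ x) ℤ.* (ℤ.+ ((suc d + 0) * 1)) ℤ.≤
    ((ℤ.+ 2) ℤ.* (ℤ.+ suc d) ℤ.+ (ℤ.+ p) ℤ.* (ℤ.+ 1)) ℤ.* (ℤ.+ M) ℤ.* (ℤ.+ 1)
  cross = subst₂ ℤ._≤_
    (trans (ℤ.pos-* x (suc d)) (cong (λ t → (ℤ.+ x) ℤ.* (ℤ.+ t)) (sym (lhs (suc d)))))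
    (trans (cong ℤ.+_ (sym (rhs (suc d) p M)))
      (trans (ℤ.pos-* ((2 * suc d + p * 1) * M) 1) (cong (ℤ._* (ℤ.+ 1))
      (trans (ℤ.pos-* (2 * suc d + p * 1) M) (cong (ℤ._* (ℤ.+ M))
      (trans (ℤ.pos-+ (2 * suc d) (p * 1)) (cong₂ ℤ._+_ (ℤ.pos-* 2 (suc d)) (ℤ.pos-* p 1))))))))
    (ℤ.+≤+ le)

1/-antitone : ∀ {k m} → k ≤ m → (ℤ.+ 1) ℚ./ suc m ℚ.≤ (ℤ.+ 1) ℚ./ suc k
1/-antitone {k} {m} k≤m = ℚ.toℚᵘ-cancel-≤ (begin
  ℚ.toℚᵘ ((ℤ.+ 1) ℚ./ suc m)   ≃⟨ toℚᵘ-/ 1 m ⟩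
  mkℚᵘ (ℤ.+ 1) m               ≤⟨ ℚᵘ.*≤* (subst₂ ℤ._≤_ (ℤ.pos-* 1 (suc k)) (ℤ.pos-* 1 (suc m)) (ℤ.+≤+ (*-monoʳ-≤ 1 (s≤s k≤m)))) ⟩
  mkℚᵘ (ℤ.+ 1) k               ≃⟨ toℚᵘ-/ 1 k ⟨
  ℚ.toℚᵘ ((ℤ.+ 1) ℚ./ suc k)   ∎)
  where open ℚᵘ.≤-Reasoning

0≤1/ : ∀ k → ℚ.0ℚ ℚ.≤ (ℤ.+ 1) ℚ./ suc k
0≤1/ k = ℚ.toℚᵘ-cancel-≤ (begin
  mkℚᵘ (ℤ.+ 0) 0               ≤⟨ ℚᵘ.*≤* (ℤ.+≤+ z≤n) ⟩
  mkℚᵘ (ℤ.+ 1) k               ≃⟨ toℚᵘ-/ 1 k ⟨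
  ℚ.toℚᵘ ((ℤ.+ 1) ℚ./ suc k)   ∎)
  where open ℚᵘ.≤-Reasoning

∣1/∣-antitone : ∀ {k m} → k ≤ m → ℚ.∣ (ℤ.+ 1) ℚ./ suc m ∣ ℚ.≤ (ℤ.+ 1) ℚ./ suc k
∣1/∣-antitone {k} {m} k≤m = subst (ℚ._≤ (ℤ.+ 1) ℚ./ suc k) (sym (ℚ.0≤p⇒∣p∣≡p (0≤1/ m))) (1/-antitone k≤m)

-- If P n (1 / (k + 1)) holds as soon as n ≥ threshold k, then P n (ε n) holds for an ε tending to 0:
-- let ε n be 1 / (k + 1) for the largest k ≤ n with threshold k ≤ n.
module Diagonal (P : ℕ → ℚ → Set) (crude : ℕ → ℚ) (crude-ok : ∀ n → P n (crude n))
  (threshold : ℕ → ℕ) (fine : ∀ k n → threshold k ≤ n → P n ((ℤ.+ 1) ℚ./ suc k)) where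

  search : ℕ → ℕ → ℚ
  next : ℕ → ℕ → ℚ
  search n k with threshold k ≤? n
  ... | yes _ = (ℤ.+ 1) ℚ./ suc k
  ... | no  _ = next n k
  -- The default when no threshold has been reached.
  next n zero    = crude n
  next n (suc k) = search n k

  search-ok : ∀ n k → P n (search n k)
  next-ok : ∀ n k → P n (next n k)
  search-ok n k with threshold k ≤? n
  ... | yes t≤n = fine k n t≤n
  ... | no  _   = next-ok n k
  next-ok n zero    = crude-ok n
  next-ok n (suc k) = search-ok n k

  search-small : ∀ n k m → threshold k ≤ n → k ≤ m → ℚ.∣ search n m ∣ ℚ.≤ (ℤ.+ 1) ℚ./ suc k
  next-small : ∀ n k m → threshold k ≤ n → k < m → ℚ.∣ next n m ∣ ℚ.≤ (ℤ.+ 1) ℚ./ suc k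
  search-small n k m t≤n k≤m with threshold m ≤? n
  ... | yes _  = ∣1/∣-antitone k≤m
  -- A failed test rules out `m` equal to `k`, so the descent cannot pass below `k`.
  ... | no t≰n = next-small n k m t≤n (≤∧≢⇒< k≤m (λ where refl → t≰n t≤n))
  next-small n k (suc m) t≤n k<1+m = search-small n k m t≤n (s≤s⁻¹ k<1+m)

  ε : ℕ → ℚ
  ε n = search n n

  ε-tendsToZero : TendsToZero ε
  -- Besides reaching the threshold, `n` must be at least `k` for the search down from `n` to meet
  -- `k`.
  ε-tendsToZero k = threshold k ⊔ k , λ n N≤n →
    search-small n k n (≤-trans (m≤m⊔n (threshold k) k) N≤n) (≤-trans (m≤n⊔m (threshold k) k) N≤n)

  diagonal : Σ (ℕ → ℚ) λ ε → TendsToZero ε × (∀ n → P n (ε n))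
  diagonal = ε , ε-tendsToZero , λ n → search-ok n n

-- Multiplying through by `n` makes sense for `n` equal to 0 as well; the error `q` is a parameter
-- for `Diagonal` to choose.
Bounded : ℕ → ℚ → Set
Bounded n q = (𝒜 : List (Subset n)) → Unique 𝒜 → NoDiffOne 𝒜 →
  toℚ (length 𝒜 * n) ℚ.≤ (toℚ 2 ℚ.+ q) ℚ.* toℚ (centralBinom n)

-- There are `suc n` levels, none larger than the central coefficient.
bounded-crude : ∀ n → Bounded n (toℚ (suc n * n))
bounded-crude n 𝒜 unique noDiffOne = ≤-from-ℕ (length 𝒜 * n) (suc n * n) 0 M (begin
  length 𝒜 * n * 1              ≡⟨ *-identityʳ _ ⟩
  length 𝒜 * n                  ≤⟨ *-monoˡ-≤ n (length-crude 𝒜 unique noDiffOne) ⟩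
  suc n * M * n                 ≡⟨ swap (suc n) M n ⟩
  suc n * n * M                 ≤⟨ *-monoˡ-≤ M (m≤n+m (suc n * n) 2) ⟩
  (2 * 1 + suc n * n) * M       ∎)
  where
  open ≤-Reasoning
  M = centralBinom n
  swap : ∀ a b c → a * b * c ≡ a * c * b
  swap = solve-∀

divisor : ℕ → ℕ
divisor e = 490 * e

quotient : ℕ → ℕ
quotient e = suc (4 * e * (2 * divisor e) ^ 5)

-- With `e` equal to `suc k`, the factor `(2 e + 1) / e` is 2 plus the error `1 / suc k`.
bounded-fine : ∀ k n → quotient (suc k) * divisor (suc k) ≤ n → Bounded n ((ℤ.+ 1) ℚ./ suc k)
bounded-fine k n large 𝒜 unique noDiffOne = ≤-from-ℕ (length 𝒜 * n) 1 k (centralBinom n)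
  (length-bound 𝒜 unique noDiffOne (suc k) (divisor (suc k)) (quotient (suc k))
    {{m*n≢0 490 (suc k)}} (s≤s z≤n) refl refl large)

theorem2 : Σ (ℕ → ℚ) λ ε → TendsToZero ε ×
    ((n : ℕ) (𝒜 : List (Subset n)) → Unique 𝒜 → NoDiffOne 𝒜 →
    toℚ (length 𝒜 * n) ℚ.≤ (toℚ 2 ℚ.+ ε n) ℚ.* toℚ (centralBinom n))
theorem2 = Diagonal.diagonal Bounded (λ n → toℚ (suc n * n)) bounded-crude
  (λ k → quotient (suc k) * divisor (suc k)) bounded-fine
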